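{- Let $G$ be a bi-regular bipartite graph, and suppose that Godsil-McKay switching (with respect to some Godsil-McKay switching partition $\{X_1,\ldots,X_\ell,Y\}$ of $V(G)$) is used to convert $G$ into $G'$. Then the graph $G'$ is also a bi-regular bipartite graph, and $G$ and $G'$ have the same degree sequences.
   Context: All graphs are finite, simple and undirected. A bipartite graph $G=(U\cup W,E)$ has its node set partitioned into $U$ and $W$ such that every edge joins a node of $U$ to a node of $W$. It is bi-regular if all nodes in $U$ have the same degree $d_u$ and all nodes in $W$ have the same degree $d_w$. The degree sequences of a bipartite graph are the two monotonic non-increasing sequences of the node degrees on the two sides of the bipartition (so they also record the number of nodes on each side). Two bipartite graphs have the same degree sequences if, for suitable bipartitions of each, these two sequences coincide. Godsil-McKay switching partition: a partition $\{X_1,\ldots,X_\ell,Y\}$ of $V(G)$ such that (1) for every $y\in Y$ and every $i\in\{1,\ldots,\ell\}$, the node $y$ has either $0$, $\frac12|X_i|$ or $|X_i|$ neighbors in $X_i$; and (2) for all $i,j\in\{1,\ldots,\ell\}$ (possibly equal), all nodes in $X_i$ have the same number of neighbors in $X_j$. Godsil-McKay switching: the graph $G'$ on the same node set is obtained from $G$ as follows. For each $y\in Y$ and each $i\in\{1,\ldots,\ell\}$ such that $y$ has exactly $\frac12|X_i|$ neighbors in $X_i$, delete the corresponding $\frac12|X_i|$ edges and join $y$ instead to the other $\frac12|X_i|$ nodes of $X_i$. All other edges and non-edges are unchanged. -}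

module Defs where

open import Data.Bool.Base using (Bool; false; not; T; if_then_else_)
open import Data.Fin.Base using (Fin)
import Data.Fin.Properties as Fin
open import Data.Fin.Subset using (Subset; _∈_; _∩_; ∁; ∣_∣; Nonempty)
open import Data.Fin.Subset.Properties using (_∈?_)
open import Data.List.Base using (List; map; filter; allFin)
import Data.List.Sort as Sort
open import Data.Maybe.Base using (Maybe; just; nothing)
import Data.Maybe.Properties as Maybe
open import Data.Nat.Base using (ℕ; _*_)
import Data.Nat.Properties as ℕ
open import Data.Product.Base using (_×_; ∃-syntax)
open import Data.Sum.Base using (_⊎_)
open import Data.Vec.Base using (tabulate)
open import Relation.Binary.PropositionalEquality
  using (_≡_; refl; trans; cong; cong₂)
open import Relation.Binary.Properties.DecTotalOrder ℕ.≤-decTotalOrder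
  using (≥-decTotalOrder)
open import Relation.Nullary.Decidable using (does)

private
  variable
    n ℓ : ℕ

record Graph (n : ℕ) : Set where
  field
    adj        : Fin n → Fin n → Bool
    adj-sym    : ∀ u v → adj u v ≡ adj v u
    adj-irrefl : ∀ v → adj v v ≡ false

open Graph public

neighbours : Graph n → Fin n → Subset n
neighbours G v = tabulate (adj G v)

degree : Graph n → Fin n → ℕ
degree G v = ∣ neighbours G v ∣

neighboursIn : Graph n → Fin n → Subset n → ℕ
neighboursIn G v S = ∣ neighbours G v ∩ S ∣

-- A bipartition of the node set is given by one side U; the other side W is ∁ U.
IsBipartition : Graph n → Subset n → Set
IsBipartition G U = ∀ u v → T (adj G u v) →
  (u ∈ U × v ∈ ∁ U) ⊎ (u ∈ ∁ U × v ∈ U)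

AllOfDegree : Graph n → Subset n → ℕ → Set
AllOfDegree G S d = ∀ v → v ∈ S → degree G v ≡ d

IsBiregularBipartite : Graph n → Set
IsBiregularBipartite G =
  ∃[ U ] IsBipartition G U
       × (∃[ d ] AllOfDegree G U d)
       × (∃[ e ] AllOfDegree G (∁ U) e)

-- Sorting with respect to ≥ makes the sequence non-increasing.
degreeSequence : Graph n → Subset n → List ℕ
degreeSequence G S =
  Sort.sort ≥-decTotalOrder (map (degree G) (filter (_∈? S) (allFin _)))

-- Comparing the sides in order loses nothing: U may be replaced by ∁ U.
SameDegreeSequences : Graph n → Graph n → Set
SameDegreeSequences G H =
  ∃[ U ] ∃[ U′ ] IsBipartition G U
               × IsBipartition H U′
               × degreeSequence G U ≡ degreeSequence H U′
               × degreeSequence G (∁ U) ≡ degreeSequence H (∁ U′)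

-- A partition {X₁, …, X_ℓ, Y} is the map sending each node to its cell:
-- just i stands for the cell Xᵢ and nothing stands for Y.
cell : (Fin n → Maybe (Fin ℓ)) → Maybe (Fin ℓ) → Subset n
cell part c = tabulate (λ v → does (Maybe.≡-dec Fin._≟_ (part v) c))

-- "½|Xᵢ| neighbours in Xᵢ" is written without division, so that it is never
-- satisfied when |Xᵢ| is odd.  The cell Y may be empty.
record GMPartition (G : Graph n) (ℓ : ℕ) : Set where
  field
    part : Fin n → Maybe (Fin ℓ)

  X : Fin ℓ → Subset n
  X i = cell part (just i)

  Y : Subset n
  Y = cell part nothing

  field
    X-nonempty : ∀ i → Nonempty (X i)
    Y-to-X     : ∀ y → y ∈ Y → ∀ i →
                 neighboursIn G y (X i) ≡ 0
                 ⊎ 2 * neighboursIn G y (X i) ≡ ∣ X i ∣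
                 ⊎ neighboursIn G y (X i) ≡ ∣ X i ∣
    X-to-X     : ∀ i j u v → u ∈ X i → v ∈ X i →
                 neighboursIn G u (X j) ≡ neighboursIn G v (X j)

module _ (G : Graph n) (P : GMPartition G ℓ) where
  open GMPartition P

  adjacentToHalf : Fin n → Fin ℓ → Bool
  adjacentToHalf y i = does (2 * neighboursIn G y (X i) ℕ.≟ ∣ X i ∣)

  -- The pair {u, v} joins some y ∈ Y to a node of some Xᵢ in which y has
  -- exactly ½|Xᵢ| neighbours.
  isSwitched : Fin n → Fin n → Bool
  isSwitched u v with part u | part v
  ... | nothing | just i  = adjacentToHalf u i
  ... | just i  | nothing = adjacentToHalf v i
  ... | nothing | nothing = false
  ... | just _  | just _  = false

  private
    isSwitched-sym : ∀ u v → isSwitched u v ≡ isSwitched v u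
    isSwitched-sym u v with part u | part v
    ... | nothing | just _  = refl
    ... | just _  | nothing = refl
    ... | nothing | nothing = refl
    ... | just _  | just _  = refl

    isSwitched-irrefl : ∀ v → isSwitched v v ≡ false
    isSwitched-irrefl v with part v
    ... | nothing = refl
    ... | just _  = refl

  -- Replacing the neighbours of y in Xᵢ by the other nodes of Xᵢ complements
  -- the adjacency between y and every node of Xᵢ.
  switch : Graph n
  switch .adj u v = if isSwitched u v then not (adj G u v) else adj G u v
  switch .adj-sym u v =
    cong₂ (λ s a → if s then not a else a) (isSwitched-sym u v) (adj-sym G u v)
  switch .adj-irrefl v =
    trans (cong (λ s → if s then not (adj G v v) else adj G v v)
                (isSwitched-irrefl v))
          (adj-irrefl G v)

{-# OPTIONS --safe #-}
-- Let y ∈ Y have half of Xᵢ as its neighbours.  If Xᵢ meets both sides of the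
-- bipartition, it meets them equally: otherwise comparing degrees within Xᵢ
-- would make d smaller on the side with fewer nodes of Xᵢ, while a neighbouring
-- cell Xⱼ, in which the ratio of the sides is reversed, would give the opposite
-- inequality.  Hence y is adjacent to all of one side of such a balanced cell,
-- and switching exchanges the sides; so G′ is bipartite once the two sides of
-- every balanced cell are interchanged.  Counting the edges between Xᵢ and Y
-- gives |Xᵢ| (deg′ v + deg v) = 2 Σ deg w, summed over w ∈ Xᵢ, for every v ∈ Xᵢ:
-- in a balanced cell the two degrees are exchanged, in a cell within one side
-- nothing changes, and other cells are not switched at all.
module Submission where

import Algebra.Properties.Semiring.Sum
open import Data.Bool.Base
  using (Bool; true; false; not; T; if_then_else_; _∧_; _xor_)
import Data.Bool.Properties as Bool
open import Data.Empty using (⊥)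
open import Data.Fin.Base using (Fin; zero; suc)
import Data.Fin.Properties as Fin
open import Data.Fin.Subset using (Subset; _∈_; _∩_; ∁; ∣_∣)
open import Data.Fin.Subset.Properties using (_∈?_)
open import Data.List.Base using (List; []; _∷_; length; map; filter; allFin; replicate)
import Data.List.Base as List
open import Data.List.Properties using (length-map)
import Data.List.Sort as Sort
open import Data.List.Relation.Binary.Permutation.Propositional using (↭-sym)
open import Data.List.Relation.Binary.Permutation.Propositional.Properties
  using (All-resp-↭; ↭-length)
open import Data.List.Relation.Unary.All using (All; []; _∷_)
import Data.List.Relation.Unary.All as All
import Data.List.Relation.Unary.All.Properties as All
open import Data.Maybe.Base using (Maybe; just; nothing; maybe′)
import Data.Maybe.Properties as Maybe
open import Data.Nat.Base
open import Data.Nat.Properties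
open import Data.Nat.Solver using (module +-*-Solver)
open import Data.Product.Base using (_×_; _,_; ∃-syntax; proj₁; proj₂)
open import Data.Sum.Base using (_⊎_; inj₁; inj₂)
open import Data.Unit.Base using (tt)
open import Data.Vec.Base using ([]; _∷_; lookup; tabulate)
open import Data.Vec.Properties
  using ([]=⇒lookup; lookup⇒[]=; lookup-map; lookup-zipWith; lookup∘tabulate)
open import Function.Base using (_∘_; id)
open import Relation.Binary.PropositionalEquality
open import Relation.Binary.Properties.DecTotalOrder ≤-decTotalOrder
  using (≥-decTotalOrder)
open import Relation.Nullary.Decidable
  using (Dec; yes; no; does; dec-true)
open import Relation.Nullary.Negation using (contradiction)
open import Relation.Unary using (Decidable)
open import Defs

open Algebra.Properties.Semiring.Sum +-*-semiring
  using (sum; sum-cong-≗; ∑-distrib-+; ∑-comm; *-distribˡ-sum; *-distribʳ-sum)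

open +-*-Solver using (solve; _:+_; _:*_; _:=_; con)

private
  variable
    n ℓ : ℕ
    A : Set

-- Indicators, finite sums of natural numbers, and cardinalities.

χ : Bool → ℕ
χ true  = 1
χ false = 0

χ-injective : ∀ {a b} → χ a ≡ χ b → a ≡ b
χ-injective {true}  {true}  _ = refl
χ-injective {false} {false} _ = refl

χ-pos : ∀ {a} → 0 < χ a → a ≡ true
χ-pos {true} _ = refl

χ≤1 : ∀ a → χ a ≤ 1
χ≤1 true  = ≤-refl
χ≤1 false = z≤n

does-true⁻ : (a? : Dec A) → does a? ≡ true → A
does-true⁻ (yes a) _ = a

does-false⁻ : (a? : Dec A) → does a? ≡ false → A → ⊥
does-false⁻ (no ¬a) _ = ¬a

sum-zero : ∀ k → sum {k} (λ _ → 0) ≡ 0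
sum-zero zero    = refl
sum-zero (suc k) = sum-zero k

sum-mono : {f g : Fin n → ℕ} → (∀ i → f i ≤ g i) → sum f ≤ sum g
sum-mono {zero}  f≤g = z≤n
sum-mono {suc n} f≤g = +-mono-≤ (f≤g zero) (sum-mono (f≤g ∘ suc))

term≤sum : (f : Fin n → ℕ) → ∀ i → f i ≤ sum f
term≤sum f zero    = m≤m+n _ _
term≤sum f (suc i) = ≤-trans (term≤sum (f ∘ suc) i) (m≤n+m _ (f zero))

sum-pos⁻ : (f : Fin n → ℕ) → 0 < sum f → ∃[ i ] 0 < f i
sum-pos⁻ {suc n} f p with f zero in eq
... | suc _ = zero , subst (0 <_) (sym eq) z<s
... | zero with sum-pos⁻ (f ∘ suc) p
...   | i , q = suc i , q

-- Equal totals leave no slack in any single term. This is the equality case that turns counting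
-- bounds into exact adjacency statements.
sum-mono-≡⁻ : {f g : Fin n → ℕ} → (∀ i → f i ≤ g i) → sum f ≡ sum g →
              ∀ i → f i ≡ g i
sum-mono-≡⁻ {suc n} {f} {g} f≤g eq zero =
  ≤-antisym (f≤g zero)
    (+-cancelʳ-≤ (sum (f ∘ suc)) (g zero) (f zero) (begin
      g zero + sum (f ∘ suc)  ≤⟨ +-monoʳ-≤ (g zero) (sum-mono (f≤g ∘ suc)) ⟩
      g zero + sum (g ∘ suc)  ≡⟨ eq ⟨
      f zero + sum (f ∘ suc)  ∎))
  where open ≤-Reasoning
sum-mono-≡⁻ {suc n} {f} {g} f≤g eq (suc i) =
  sum-mono-≡⁻ (f≤g ∘ suc)
    (+-cancelˡ-≡ (f zero) _ _
      (trans eq (cong (_+ sum (g ∘ suc)) (sym (sum-mono-≡⁻ f≤g eq zero))))) i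

∣∣≡sum : (p : Subset n) → ∣ p ∣ ≡ sum (χ ∘ lookup p)
∣∣≡sum []          = refl
∣∣≡sum (true ∷ p)  = cong suc (∣∣≡sum p)
∣∣≡sum (false ∷ p) = ∣∣≡sum p

∣tabulate∣≡sum : (f : Fin n → Bool) → ∣ tabulate f ∣ ≡ sum (χ ∘ f)
∣tabulate∣≡sum f =
  trans (∣∣≡sum (tabulate f)) (sum-cong-≗ (cong χ ∘ lookup∘tabulate f))

does-∈? : (p : Subset n) (v : Fin n) → does (v ∈? p) ≡ lookup p v
does-∈? (true  ∷ p) zero    = refl
does-∈? (false ∷ p) zero    = refl
does-∈? (_     ∷ p) (suc v) = does-∈? p v

∈∁⇒lookup : {p : Subset n} {v : Fin n} → v ∈ ∁ p → lookup p v ≡ false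
∈∁⇒lookup {p = p} {v} v∈∁p = Bool.not-injective
  (trans (sym (lookup-map v not p)) ([]=⇒lookup v∈∁p))

lookup⇒∈∁ : {p : Subset n} {v : Fin n} → lookup p v ≡ false → v ∈ ∁ p
lookup⇒∈∁ {p = p} {v} eq =
  lookup⇒[]= v (∁ p) (trans (lookup-map v not p) (cong not eq))

-- Degree sequences of sets of constant degree.

length-filter-tabulate : {P : A → Set} (P? : Decidable P) (f : Fin n → A) →
  length (filter P? (List.tabulate f)) ≡ sum (λ i → χ (does (P? (f i))))
length-filter-tabulate {n = zero}  P? f = refl
length-filter-tabulate {n = suc n} P? f with does (P? (f zero))
... | true  = cong suc (length-filter-tabulate P? (f ∘ suc))
... | false = length-filter-tabulate P? (f ∘ suc)

All-≡⇒replicate : {x : A} {xs : List A} → All (_≡ x) xs →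
                  xs ≡ replicate (length xs) x
All-≡⇒replicate []         = refl
All-≡⇒replicate (refl ∷ p) = cong (_ ∷_) (All-≡⇒replicate p)

-- Sorting is a permutation, so it keeps the length and the common value of the entries; a constant
-- list is determined by these two.
degreeSequence-const : (G : Graph n) (S : Subset n) {d : ℕ} →
  AllOfDegree G S d → degreeSequence G S ≡ replicate ∣ S ∣ d
degreeSequence-const {n} G S {d} deg =
  trans (All-≡⇒replicate (All-resp-↭ (↭-sym (Sort.sort-↭ ≥-decTotalOrder degs)) all≡))
        (cong (λ k → replicate k d) len)
  where
  open ≡-Reasoning
  nodes = filter (_∈? S) (allFin n)
  degs  = map (degree G) nodes
  all≡ : All (_≡ d) degs
  all≡ = All.map⁺ (All.map (deg _) (All.all-filter (_∈? S) (allFin n)))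
  len : length (degreeSequence G S) ≡ ∣ S ∣
  len = begin
    length (degreeSequence G S)         ≡⟨ ↭-length (Sort.sort-↭ ≥-decTotalOrder degs) ⟩
    length degs                         ≡⟨ length-map (degree G) nodes ⟩
    length nodes                        ≡⟨ length-filter-tabulate (_∈? S) id ⟩
    sum (λ v → χ (does (v ∈? S)))       ≡⟨ sum-cong-≗ (λ v → cong χ (does-∈? S v)) ⟩
    sum (χ ∘ lookup S)                  ≡⟨ ∣∣≡sum S ⟨
    ∣ S ∣                               ∎

-- Bipartitions as two-colourings.

is : Bool → Bool → Bool
is b c = if b then c else not c

-- An equation for the colour of `v` composes with other equations between colours, unlike the
-- disjunction in `IsBipartition`.
IsColouring : Graph n → (Fin n → Bool) → Set
IsColouring G s = ∀ u v → adj G u v ≡ true → s v ≡ not (s u)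

bipartition⇒colouring : {G : Graph n} {U : Subset n} →
  IsBipartition G U → IsColouring G (lookup U)
bipartition⇒colouring bip u v e with bip u v (subst T (sym e) tt)
... | inj₁ (u∈ , v∈) = trans (∈∁⇒lookup v∈) (cong not (sym ([]=⇒lookup u∈)))
... | inj₂ (u∈ , v∈) = trans ([]=⇒lookup v∈) (cong not (sym (∈∁⇒lookup u∈)))

colouring⇒bipartition : {G : Graph n} {U : Subset n} →
  IsColouring G (lookup U) → IsBipartition G U
colouring⇒bipartition {G = G} {U} col u v t with adj G u v in e
... | true with lookup U u in p | lookup U v in q | col u v e
...   | true  | false | _ = inj₁ (lookup⇒[]= u U p , lookup⇒∈∁ q)
...   | false | true  | _ = inj₂ (lookup⇒∈∁ p , lookup⇒[]= v U q)

-- Sums over the cells of a partition.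

module CellSums (part : Fin n → Maybe (Fin ℓ)) where

  ⟦_⟧ : Maybe (Fin ℓ) → Fin n → ℕ
  ⟦ c ⟧ v = χ (does (Maybe.≡-dec Fin._≟_ (part v) c))

  -- A sum over all nodes weighted by an indicator, so that sums over different cells share one
  -- index type and can be interchanged. The decision inside `⟦_⟧` is the one that defines `cell`.
  Σ∈ : Maybe (Fin ℓ) → (Fin n → ℕ) → ℕ
  Σ∈ c f = sum (λ v → ⟦ c ⟧ v * f v)

  size : Maybe (Fin ℓ) → ℕ
  size c = Σ∈ c (λ _ → 1)

  module _ {c : Maybe (Fin ℓ)} where

    Σ∈-cong : {f g : Fin n → ℕ} → (∀ v → part v ≡ c → f v ≡ g v) → Σ∈ c f ≡ Σ∈ c g
    Σ∈-cong {f} {g} f≡g = sum-cong-≗ pointwise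
      where
      pointwise : ∀ v → ⟦ c ⟧ v * f v ≡ ⟦ c ⟧ v * g v
      pointwise v with Maybe.≡-dec Fin._≟_ (part v) c
      ... | yes p = cong (1 *_) (f≡g v p)
      ... | no  _ = refl

    private
      ⟦⟧-mono : {f g : Fin n → ℕ} → (∀ v → part v ≡ c → f v ≤ g v) →
                ∀ v → ⟦ c ⟧ v * f v ≤ ⟦ c ⟧ v * g v
      ⟦⟧-mono f≤g v with Maybe.≡-dec Fin._≟_ (part v) c
      ... | yes p = *-monoʳ-≤ 1 (f≤g v p)
      ... | no  _ = z≤n

      ⟦⟧-member : ∀ {v} → part v ≡ c → ⟦ c ⟧ v ≡ 1
      ⟦⟧-member p = cong χ (dec-true (Maybe.≡-dec Fin._≟_ _ c) p)

    Σ∈-mono : {f g : Fin n → ℕ} → (∀ v → part v ≡ c → f v ≤ g v) → Σ∈ c f ≤ Σ∈ c g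
    Σ∈-mono f≤g = sum-mono (⟦⟧-mono f≤g)

    Σ∈-mono-≡⁻ : {f g : Fin n → ℕ} → (∀ v → part v ≡ c → f v ≤ g v) →
                 Σ∈ c f ≡ Σ∈ c g → ∀ v → part v ≡ c → f v ≡ g v
    Σ∈-mono-≡⁻ {f} {g} f≤g eq v p = *-cancelˡ-≡ (f v) (g v) 1
      (subst (λ k → k * f v ≡ k * g v) (⟦⟧-member p)
             (sum-mono-≡⁻ (⟦⟧-mono f≤g) eq v))

    term≤Σ∈ : (f : Fin n → ℕ) → ∀ v → part v ≡ c → f v ≤ Σ∈ c f
    term≤Σ∈ f v p = subst (_≤ Σ∈ c f)
      (trans (cong (_* f v) (⟦⟧-member p)) (*-identityˡ (f v)))
      (term≤sum (λ w → ⟦ c ⟧ w * f w) v)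

    Σ∈-pos⁻ : (f : Fin n → ℕ) → 0 < Σ∈ c f → ∃[ v ] part v ≡ c × 0 < f v
    Σ∈-pos⁻ f pos with sum-pos⁻ (λ w → ⟦ c ⟧ w * f w) pos
    ... | v , q with Maybe.≡-dec Fin._≟_ (part v) c
    ...   | yes p = v , p , subst (0 <_) (*-identityˡ (f v)) q

  module _ (c : Maybe (Fin ℓ)) where

    Σ∈-+ : (f g : Fin n → ℕ) → Σ∈ c (λ v → f v + g v) ≡ Σ∈ c f + Σ∈ c g
    Σ∈-+ f g = trans (sum-cong-≗ (λ v → *-distribˡ-+ (⟦ c ⟧ v) (f v) (g v)))
                     (∑-distrib-+ (λ v → ⟦ c ⟧ v * f v) (λ v → ⟦ c ⟧ v * g v))

    *-Σ∈ : ∀ k (f : Fin n → ℕ) → k * Σ∈ c f ≡ Σ∈ c (λ v → k * f v)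
    *-Σ∈ k f = trans (*-distribˡ-sum k (λ v → ⟦ c ⟧ v * f v))
      (sum-cong-≗ (λ v → solve 3 (λ k x y → k :* (x :* y) := x :* (k :* y)) refl
                               k (⟦ c ⟧ v) (f v)))

    Σ∈-* : (f : Fin n → ℕ) → ∀ k → Σ∈ c f * k ≡ Σ∈ c (λ v → f v * k)
    Σ∈-* f k = trans (*-distribʳ-sum k (λ v → ⟦ c ⟧ v * f v))
      (sum-cong-≗ (λ v → *-assoc (⟦ c ⟧ v) (f v) k))

    Σ∈-const : ∀ k → Σ∈ c (λ _ → k) ≡ size c * k
    Σ∈-const k = sym (trans (Σ∈-* (λ _ → 1) k) (Σ∈-cong {c} (λ _ _ → *-identityˡ k)))

  Σ∈-comm : ∀ c e (f : Fin n → Fin n → ℕ) →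
            Σ∈ c (λ u → Σ∈ e (f u)) ≡ Σ∈ e (λ v → Σ∈ c (λ u → f u v))
  Σ∈-comm c e f = begin
    Σ∈ c (λ u → Σ∈ e (f u))
      ≡⟨ sum-cong-≗ (λ u → *-distribˡ-sum (⟦ c ⟧ u) (λ v → ⟦ e ⟧ v * f u v)) ⟩
    sum (λ u → sum (λ v → ⟦ c ⟧ u * (⟦ e ⟧ v * f u v)))
      ≡⟨ ∑-comm (λ u v → ⟦ c ⟧ u * (⟦ e ⟧ v * f u v)) ⟩
    sum (λ v → sum (λ u → ⟦ c ⟧ u * (⟦ e ⟧ v * f u v)))
      ≡⟨ sum-cong-≗ (λ v → sum-cong-≗ (λ u →
           solve 3 (λ x y z → x :* (y :* z) := y :* (x :* z)) refl
                 (⟦ c ⟧ u) (⟦ e ⟧ v) (f u v))) ⟩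
    sum (λ v → sum (λ u → ⟦ e ⟧ v * (⟦ c ⟧ u * f u v)))
      ≡⟨ sum-cong-≗ (λ v → *-distribˡ-sum (⟦ e ⟧ v) (λ u → ⟦ c ⟧ u * f u v)) ⟨
    Σ∈ e (λ v → Σ∈ c (λ u → f u v)) ∎
    where open ≡-Reasoning

  private
    δ-sum : ∀ {k} (i : Fin k) → sum (λ j → χ (does (i Fin.≟ j))) ≡ 1
    δ-sum {suc k} zero    = cong suc (sum-zero k)
    δ-sum {suc k} (suc i) = δ-sum i

    exactly-one-cell : ∀ v → ⟦ nothing ⟧ v + sum (λ i → ⟦ just i ⟧ v) ≡ 1
    exactly-one-cell v with part v
    ... | just i  = δ-sum i
    ... | nothing = cong suc (sum-zero ℓ)

  -- At every node exactly one cell indicator is 1, so their sum may be inserted as a factor;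
  -- interchanging the sums collects the terms cell by cell.
  sum-by-cells : (f : Fin n → ℕ) →
                 sum f ≡ Σ∈ nothing f + sum (λ i → Σ∈ (just i) f)
  sum-by-cells f = begin
    sum f
      ≡⟨ sum-cong-≗ (λ v → sym (trans (cong (_* f v) (exactly-one-cell v)) (*-identityˡ (f v)))) ⟩
    sum (λ v → (⟦ nothing ⟧ v + sum (λ i → ⟦ just i ⟧ v)) * f v)
      ≡⟨ sum-cong-≗ (λ v → trans (*-distribʳ-+ (f v) (⟦ nothing ⟧ v) _)
           (cong (⟦ nothing ⟧ v * f v +_) (*-distribʳ-sum (f v) (λ i → ⟦ just i ⟧ v)))) ⟩
    sum (λ v → ⟦ nothing ⟧ v * f v + sum (λ i → ⟦ just i ⟧ v * f v))
      ≡⟨ ∑-distrib-+ (λ v → ⟦ nothing ⟧ v * f v) (λ v → sum (λ i → ⟦ just i ⟧ v * f v)) ⟩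
    Σ∈ nothing f + sum (λ v → sum (λ i → ⟦ just i ⟧ v * f v))
      ≡⟨ cong (Σ∈ nothing f +_) (∑-comm (λ v i → ⟦ just i ⟧ v * f v)) ⟩
    Σ∈ nothing f + sum (λ i → Σ∈ (just i) f) ∎
    where open ≡-Reasoning

-- Adjacency counts of a switching partition in a coloured graph.

module Switching
  (G : Graph n) (s : Fin n → Bool) (colouring : IsColouring G s)
  (d : Bool → ℕ) (deg : ∀ v → degree G v ≡ d (s v))
  (P : GMPartition G ℓ)
  where

  open GMPartition P
  open CellSums part
  open ≤-Reasoning

  G′ : Graph n
  G′ = switch G P

  E E′ : Fin n → Fin n → ℕ
  E  u v = χ (adj G u v)
  E′ u v = χ (adj G′ u v)

  E-sym : ∀ u v → E u v ≡ E v u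
  E-sym u v = cong χ (adj-sym G u v)

  half : Fin n → Fin ℓ → Bool
  half = adjacentToHalf G P

  nb : Fin n → Fin ℓ → ℕ
  nb v i = Σ∈ (just i) (E v)

  ∈X⇒part : ∀ {v i} → v ∈ X i → part v ≡ just i
  ∈X⇒part {v} {i} v∈ = does-true⁻ (Maybe.≡-dec Fin._≟_ (part v) (just i))
    (trans (sym (lookup∘tabulate _ v)) ([]=⇒lookup v∈))

  part⇒∈cell : ∀ {v c} → part v ≡ c → v ∈ cell part c
  part⇒∈cell {v} {c} p = lookup⇒[]= v (cell part c)
    (trans (lookup∘tabulate _ v) (dec-true (Maybe.≡-dec Fin._≟_ (part v) c) p))

  neighboursIn≡nb : ∀ v i → neighboursIn G v (X i) ≡ nb v i
  neighboursIn≡nb v i = trans (∣∣≡sum (neighbours G v ∩ X i)) (sum-cong-≗ pointwise)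
    where
    χ-∧ : ∀ a b → χ (a ∧ b) ≡ χ b * χ a
    χ-∧ true  true  = refl
    χ-∧ true  false = refl
    χ-∧ false true  = refl
    χ-∧ false false = refl
    pointwise : ∀ w → χ (lookup (neighbours G v ∩ X i) w) ≡ ⟦ just i ⟧ w * E v w
    pointwise w = begin-equality
      χ (lookup (neighbours G v ∩ X i) w)
        ≡⟨ cong χ (lookup-zipWith _∧_ w (neighbours G v) (X i)) ⟩
      χ (lookup (neighbours G v) w ∧ lookup (X i) w)
        ≡⟨ χ-∧ (lookup (neighbours G v) w) (lookup (X i) w) ⟩
      χ (lookup (X i) w) * χ (lookup (neighbours G v) w)
        ≡⟨ cong₂ (λ a b → χ a * χ b) (lookup∘tabulate _ w) (lookup∘tabulate _ w) ⟩
      ⟦ just i ⟧ w * E v w ∎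

  ∣X∣≡size : ∀ i → ∣ X i ∣ ≡ size (just i)
  ∣X∣≡size i = trans (∣tabulate∣≡sum (λ w → does (Maybe.≡-dec Fin._≟_ (part w) (just i))))
    (sum-cong-≗ (λ w → sym (*-identityʳ (⟦ just i ⟧ w))))

  degree≡sum : ∀ v → degree G v ≡ sum (E v)
  degree≡sum v = ∣tabulate∣≡sum (adj G v)

  degree′≡sum : ∀ v → degree G′ v ≡ sum (E′ v)
  degree′≡sum v = ∣tabulate∣≡sum (adj G′ v)

  sum-E : ∀ v → sum (E v) ≡ d (s v)
  sum-E v = trans (sym (degree≡sum v)) (deg v)

  half-true : ∀ {y i} → half y i ≡ true → 2 * nb y i ≡ size (just i)
  half-true {y} {i} h = begin-equality
    2 * nb y i                    ≡⟨ cong (2 *_) (neighboursIn≡nb y i) ⟨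
    2 * neighboursIn G y (X i)    ≡⟨ does-true⁻ (2 * neighboursIn G y (X i) ≟ ∣ X i ∣) h ⟩
    ∣ X i ∣                       ≡⟨ ∣X∣≡size i ⟩
    size (just i)                 ∎

  -- Deciding `half` first makes the middle alternative exclude the other two, so each case also
  -- tells whether the switch acts between `y` and `X i`.
  none-half-all : ∀ {y} → part y ≡ nothing → ∀ i →
    (half y i ≡ false × nb y i ≡ 0)
    ⊎ half y i ≡ true
    ⊎ (half y i ≡ false × nb y i ≡ size (just i))
  none-half-all {y} p i with half y i in e | Y-to-X y (part⇒∈cell p) i
  ... | true  | _             = inj₂ (inj₁ refl)
  ... | false | inj₁ none     =
    inj₁ (refl , trans (sym (neighboursIn≡nb y i)) none)
  ... | false | inj₂ (inj₂ all) =
    inj₂ (inj₂ (refl , trans (sym (neighboursIn≡nb y i)) (trans all (∣X∣≡size i))))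
  ... | false | inj₂ (inj₁ h) =
    contradiction h (does-false⁻ (2 * neighboursIn G y (X i) ≟ ∣ X i ∣) e)

  -- The quotient matrix of the cells `X i`, which form an equitable partition of their union. The
  -- witness of nonemptiness serves as the representative of its cell.
  a : Fin ℓ → Fin ℓ → ℕ
  a i j = nb (proj₁ (X-nonempty i)) j

  nb≡a : ∀ {u i} → part u ≡ just i → ∀ j → nb u j ≡ a i j
  nb≡a {u} {i} p j = begin-equality
    nb u j                                        ≡⟨ neighboursIn≡nb u j ⟨
    neighboursIn G u (X j)                        ≡⟨ X-to-X i j _ _ (part⇒∈cell p) (proj₂ (X-nonempty i)) ⟩
    neighboursIn G (proj₁ (X-nonempty i)) (X j)   ≡⟨ neighboursIn≡nb _ j ⟩
    a i j                                         ∎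

  size-pos : ∀ i → 0 < size (just i)
  size-pos i = term≤Σ∈ {just i} (λ _ → 1) _ (∈X⇒part (proj₂ (X-nonempty i)))

  -- Colour classes inside a cell and the edges that meet them.

  C : Bool → Fin n → ℕ
  C b v = χ (is b (s v))

  m : Fin ℓ → Bool → ℕ
  m i b = Σ∈ (just i) (C b)

  is-self : ∀ b → is b b ≡ true
  is-self true  = refl
  is-self false = refl

  is⇒≡ : ∀ b {c} → is b c ≡ true → c ≡ b
  is⇒≡ true  eq = eq
  is⇒≡ false eq = Bool.not-injective eq

  C+C≡1 : ∀ b v → C b v + C (not b) v ≡ 1
  C+C≡1 b v with b | s v
  ... | true  | true  = refl
  ... | true  | false = refl
  ... | false | true  = refl
  ... | false | false = refl

  m+m≡size : ∀ i b → m i b + m i (not b) ≡ size (just i)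
  m+m≡size i b = trans (sym (Σ∈-+ (just i) (C b) (C (not b))))
    (Σ∈-cong {just i} (λ v _ → C+C≡1 b v))

  m-pos : ∀ {v i} → part v ≡ just i → ∀ {b} → s v ≡ b → 0 < m i b
  m-pos {v} p refl = ≤-trans (≤-reflexive (cong χ (sym (is-self (s v)))))
    (term≤Σ∈ (C (s v)) v p)

  m-pos⁻ : ∀ {i b} → 0 < m i b → ∃[ v ] part v ≡ just i × s v ≡ b
  m-pos⁻ {i} {b} pos with Σ∈-pos⁻ {just i} (C b) pos
  ... | v , p , q = v , p , is⇒≡ b (χ-pos q)

  E≤C : ∀ y v → E y v ≤ C (not (s y)) v
  E≤C y v with adj G y v in e
  ... | false = z≤n
  ... | true  = ≤-reflexive (cong χ (sym
    (trans (cong (is (not (s y))) (colouring y v e)) (is-self (not (s y))))))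

  nb≤m : ∀ y i → nb y i ≤ m i (not (s y))
  nb≤m y i = Σ∈-mono {just i} (λ v _ → E≤C y v)

  -- All neighbours of `y` have the opposite colour, so half of the cell fits into the opposite
  -- class.
  half⇒m≤m : ∀ {y i} → half y i ≡ true → m i (s y) ≤ m i (not (s y))
  half⇒m≤m {y} {i} h = +-cancelʳ-≤ (m i (not (s y))) _ _ (begin
    m i (s y) + m i (not (s y))          ≡⟨ m+m≡size i (s y) ⟩
    size (just i)                        ≡⟨ sym (half-true h) ⟩
    2 * nb y i                           ≤⟨ *-monoʳ-≤ 2 (nb≤m y i) ⟩
    2 * m i (not (s y))                  ≡⟨ cong (m i (not (s y)) +_) (+-identityʳ _) ⟩
    m i (not (s y)) + m i (not (s y))    ∎)


  -- The edge rules out no neighbours in the cell, and a node of the colour of `y` rules out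
  -- adjacency to the whole cell. Only one half remains.
  adjacent⇒half : ∀ {y x i} → part y ≡ nothing → part x ≡ just i →
    adj G y x ≡ true → 0 < m i (s y) → half y i ≡ true
  adjacent⇒half {y} {x} {i} py px e pos with none-half-all py i
  ... | inj₁ (_ , none)        = contradiction (subst (1 ≤_) none
    (≤-trans (≤-reflexive (cong χ (sym e))) (term≤Σ∈ (E y) x px))) (λ ())
  ... | inj₂ (inj₁ h)          = h
  ... | inj₂ (inj₂ (_ , full)) = contradiction (begin-strict
    size (just i)                    ≡⟨ full ⟨
    nb y i                           ≤⟨ nb≤m y i ⟩
    m i (not (s y))                  <⟨ m<n+m _ pos ⟩
    m i (s y) + m i (not (s y))      ≡⟨ m+m≡size i (s y) ⟩
    size (just i)                    ∎) (<-irrefl refl)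

  -- The neighbours of `y` in the cell lie in the opposite class, and both sets contain exactly half
  -- of the cell.
  half-balanced⇒E≡C : ∀ {y i} → half y i ≡ true → m i (s y) ≡ m i (not (s y)) →
    ∀ x → part x ≡ just i → E y x ≡ C (not (s y)) x
  half-balanced⇒E≡C {y} {i} h bal = Σ∈-mono-≡⁻ {just i} (λ v _ → E≤C y v)
    (*-cancelˡ-≡ (nb y i) (m i b) 2 (begin-equality
      2 * nb y i              ≡⟨ half-true h ⟩
      size (just i)           ≡⟨ m+m≡size i (s y) ⟨
      m i (s y) + m i b       ≡⟨ cong (_+ m i b) bal ⟩
      m i b + m i b           ≡⟨ cong (m i b +_) (+-identityʳ _) ⟨
      2 * m i b               ∎))
    where b = not (s y)

  -- Edges from nodes of colour `b` in `X i` to `X j` end in the other colour; they are counted from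
  -- both ends. If such edges exist, the ratio of the two classes in `X j` is the reverse of that in
  -- `X i`.
  double-count : ∀ i j b → m i b * a i j ≡ m j (not b) * a j i
  double-count i j b = begin-equality
    m i b * a i j
      ≡⟨ Σ∈-* (just i) (C b) (a i j) ⟩
    Σ∈ (just i) (λ u → C b u * a i j)
      ≡⟨ Σ∈-cong {just i} (λ u p → trans (cong (C b u *_) (sym (nb≡a p j)))
                                         (*-Σ∈ (just j) (C b u) (E u))) ⟩
    Σ∈ (just i) (λ u → Σ∈ (just j) (λ v → C b u * E u v))
      ≡⟨ Σ∈-cong {just i} (λ u _ → Σ∈-cong {just j} (λ v _ → flip-edge u v)) ⟩
    Σ∈ (just i) (λ u → Σ∈ (just j) (λ v → C (not b) v * E v u))
      ≡⟨ Σ∈-comm (just i) (just j) (λ u v → C (not b) v * E v u) ⟩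
    Σ∈ (just j) (λ v → Σ∈ (just i) (λ u → C (not b) v * E v u))
      ≡⟨ Σ∈-cong {just j} (λ v p → trans (cong (C (not b) v *_) (sym (nb≡a p i)))
                                         (*-Σ∈ (just i) (C (not b) v) (E v))) ⟨
    Σ∈ (just j) (λ v → C (not b) v * a j i)
      ≡⟨ Σ∈-* (just j) (C (not b)) (a j i) ⟨
    m j (not b) * a j i ∎
    where
    is-not-not : ∀ b c → is b c ≡ is (not b) (not c)
    is-not-not true  c = sym (Bool.not-involutive c)
    is-not-not false c = refl
    flip-edge : ∀ u v → C b u * E u v ≡ C (not b) v * E v u
    flip-edge u v rewrite adj-sym G v u with adj G u v in e
    ... | true  = cong (λ c → χ c * 1)
      (trans (is-not-not b (s u)) (cong (is (not b)) (sym (colouring u v e))))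
    ... | false = trans (*-zeroʳ (C b u)) (sym (*-zeroʳ (C (not b) v)))

  edge⇒a-pos : ∀ {u v i j} → part u ≡ just i → part v ≡ just j →
               adj G u v ≡ true → 0 < a i j
  edge⇒a-pos {u} {v} {i} {j} pu pv e = begin
    1        ≡⟨ cong χ e ⟨
    E u v    ≤⟨ term≤Σ∈ (E u) v pv ⟩
    nb u j   ≡⟨ nb≡a pu j ⟩
    a i j    ∎

  -- Comparison of degrees within a cell.

  degY : Fin n → ℕ
  degY v = Σ∈ nothing (E v)

  degX : Fin ℓ → ℕ
  degX i = sum (a i)

  -- `degX i` depends on the cell alone, so within one cell degrees differ only through the number
  -- of neighbours in `Y`.
  degree-split : ∀ {v i} → part v ≡ just i → d (s v) ≡ degY v + degX i
  degree-split {v} {i} p = begin-equality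
    d (s v)                           ≡⟨ sum-E v ⟨
    sum (E v)                         ≡⟨ sum-by-cells (E v) ⟩
    degY v + sum (λ j → nb v j)         ≡⟨ cong (degY v +_) (sum-cong-≗ (nb≡a p)) ⟩
    degY v + degX i                       ∎

  degX≤d : ∀ {i b} → 0 < m i b → degX i ≤ d b
  degX≤d {i} pos with m-pos⁻ pos
  ... | v , p , refl = begin
    degX i             ≤⟨ m≤n+m (degX i) (degY v) ⟩
    degY v + degX i      ≡⟨ degree-split p ⟨
    d (s v)          ∎

  -- A Y-neighbour of a node of the smaller colour class would have half of the
  -- cell as its neighbours, all of them in that smaller class.
  minority⇒d≡degX : ∀ {i b} → 0 < m i b → m i b < m i (not b) → d b ≡ degX i
  minority⇒d≡degX {i} pos lt with m-pos⁻ pos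
  ... | v , p , refl = trans (degree-split p) (cong (_+ degX i) degY≡0)
    where
    not-adjacent : ∀ y → part y ≡ nothing → E v y ≡ 0
    not-adjacent y py with adj G v y in e
    ... | false = refl
    ... | true  = contradiction lt (≤⇒≯ (subst (λ c → m i (not (s v)) ≤ m i c)
        (trans (cong not sy) (Bool.not-involutive (s v)))
        (subst (λ c → m i c ≤ m i (not (s y))) sy (half⇒m≤m h))))
      where
      sy = colouring v y e
      h = adjacent⇒half py p (trans (adj-sym G y v) e)
            (subst (λ c → 0 < m i c) (sym sy) (<-trans pos lt))
    degY≡0 : degY v ≡ 0
    degY≡0 = trans (Σ∈-cong {nothing} not-adjacent)
      (trans (Σ∈-const nothing 0) (*-zeroʳ (size nothing)))

  -- If X i is unbalanced with y's colour b in the minority, comparing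
  -- degrees within X i gives d b < d (not b).  A node of colour b in X i has a
  -- neighbour in some X j, where the ratio of the classes is reversed, and
  -- comparing degrees within X j gives d (not b) ≤ d b.
  half⇒¬minority : ∀ {y i} → part y ≡ nothing → half y i ≡ true →
    0 < m i (s y) → m i (s y) < m i (not (s y)) → ⊥
  half⇒¬minority {y} {i} py h pos lt = <⇒≱ db<dnb dnb≤db
    where
    b = s y
    nb-pos : 0 < nb y i
    nb-pos = *-cancelˡ-< 2 0 (nb y i) (subst (0 <_) (sym (half-true h)) (size-pos i))
    db<dnb : d b < d (not b)
    db<dnb with Σ∈-pos⁻ {just i} (E y) nb-pos
    ... | w , p , Eyw = begin-strict
      d b            ≡⟨ minority⇒d≡degX pos lt ⟩
      -- Strict because `y` itself is counted in `degY w`.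
      degX i           <⟨ m<n+m (degX i) (≤-trans (subst (0 <_) (E-sym y w) Eyw) (term≤Σ∈ (E w) y py)) ⟩
      degY w + degX i    ≡⟨ degree-split p ⟨
      d (s w)        ≡⟨ cong d (colouring y w (χ-pos Eyw)) ⟩
      d (not b)      ∎
    -- `degX i` equals `d b`, which is also the degree of `y`, and `y` has neighbours in `X i`.
    degX-pos : 0 < degX i
    degX-pos = begin-strict
      0             <⟨ nb-pos ⟩
      nb y i        ≤⟨ term≤sum (nb y) i ⟩
      sum (nb y)    ≤⟨ m≤n+m _ (degY y) ⟩
      degY y + sum (nb y)   ≡⟨ sum-by-cells (E y) ⟨
      sum (E y)     ≡⟨ sum-E y ⟩
      d b           ≡⟨ minority⇒d≡degX pos lt ⟩
      degX i          ∎
    dnb≤db : d (not b) ≤ d b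
    dnb≤db with sum-pos⁻ (a i) degX-pos | m-pos⁻ pos
    ... | j , aij-pos | v , pv , sv with Σ∈-pos⁻ {just j} (E v) (subst (0 <_) (sym (nb≡a pv j)) aij-pos)
    ...   | z , pz , Evz = begin
      d (not b)   ≡⟨ minority⇒d≡degX mjnb-pos (subst (λ c → m j (not b) < m j c) (sym (Bool.not-involutive b)) mj<) ⟩
      degX j        ≤⟨ degX≤d (<-trans mjnb-pos mj<) ⟩
      d b         ∎
      where
      e = χ-pos Evz
      mjnb-pos : 0 < m j (not b)
      mjnb-pos = m-pos pz (trans (colouring v z e) (cong not sv))
      mj< : m j (not b) < m j b
      mj< = *-cancelʳ-< (a j i) (m j (not b)) (m j b) (begin-strict
        m j (not b) * a j i         ≡⟨ double-count i j b ⟨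
        m i b * a i j               <⟨ *-monoˡ-< (a i j) {{>-nonZero aij-pos}} lt ⟩
        m i (not b) * a i j         ≡⟨ double-count i j (not b) ⟩
        m j (not (not b)) * a j i   ≡⟨ cong (λ c → m j c * a j i) (Bool.not-involutive b) ⟩
        m j b * a j i               ∎)

  -- `half⇒m≤m` excludes that the class of the colour of `y` is the larger one, and `half⇒¬minority`
  -- that it is smaller and nonempty.
  half⇒pure⊎balanced : ∀ {y i} → part y ≡ nothing → half y i ≡ true →
    m i (s y) ≡ 0 ⊎ m i (s y) ≡ m i (not (s y))
  half⇒pure⊎balanced {y} {i} py h with m i (s y) ≟ 0 | m i (s y) <? m i (not (s y))
  ... | yes empty | _       = inj₁ empty
  ... | no ¬empty  | yes lt  = contradiction lt (half⇒¬minority py h (n≢0⇒n>0 ¬empty))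
  ... | no _      | no ¬lt  = inj₂ (≤-antisym (half⇒m≤m h) (≮⇒≥ ¬lt))

  -- Balanced cells and the colouring of the switched graph.

  balanced : Fin ℓ → Bool
  balanced i = does (m i true ≟ m i false)

  balanced⇒≡ : ∀ {i} → balanced i ≡ true → ∀ b → m i b ≡ m i (not b)
  balanced⇒≡ {i} bal true  = does-true⁻ (m i true ≟ m i false) bal
  balanced⇒≡ {i} bal false = sym (does-true⁻ (m i true ≟ m i false) bal)

  ≡⇒balanced : ∀ {i} b → m i b ≡ m i (not b) → balanced i ≡ true
  ≡⇒balanced {i} true  eq = dec-true (m i true ≟ m i false) eq
  ≡⇒balanced {i} false eq = dec-true (m i true ≟ m i false) (sym eq)

  half-unbalanced⇒pure : ∀ {y i} → part y ≡ nothing → half y i ≡ true →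
    balanced i ≡ false → m i (s y) ≡ 0
  half-unbalanced⇒pure {y} {i} py h unbal with half⇒pure⊎balanced py h
  ... | inj₁ pure = pure
  ... | inj₂ bal  = contradiction (trans (sym (≡⇒balanced {i} (s y) bal)) unbal) (λ ())

  -- Every balanced cell exchanges its colours, even if no node of `Y` is attached to half of it: an
  -- edge between cells `X i` and `X j` joins two balanced or two unbalanced cells, so its ends flip
  -- together or not at all. The default `false` keeps the colours on `Y`.
  s′ : Fin n → Bool
  s′ v = maybe′ balanced false (part v) xor s v

  s′-Y : ∀ {y} → part y ≡ nothing → s′ y ≡ s y
  s′-Y p rewrite p = refl

  s′-X : ∀ {x i} → part x ≡ just i → s′ x ≡ balanced i xor s x
  s′-X p rewrite p = refl

  switched : Bool → Bool → Bool
  switched h e = if h then not e else e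

  adj′-YX : ∀ {y x i} → part y ≡ nothing → part x ≡ just i →
            adj G′ y x ≡ switched (half y i) (adj G y x)
  adj′-YX p q rewrite p | q = refl

  adj′-YY : ∀ {y z} → part y ≡ nothing → part z ≡ nothing → adj G′ y z ≡ adj G y z
  adj′-YY p q rewrite p | q = refl

  adj′-XX : ∀ {u v i j} → part u ≡ just i → part v ≡ just j → adj G′ u v ≡ adj G u v
  adj′-XX p q rewrite p | q = refl

  -- Double counting for both colours carries equality of the classes from `X i` to `X j`, up to the
  -- factor `a j i`, which the edge makes positive.
  edge⇒balanced-mono : ∀ {u v i j} → part u ≡ just i → part v ≡ just j →
    adj G u v ≡ true → balanced i ≡ true → balanced j ≡ true
  edge⇒balanced-mono {u} {v} {i} {j} pu pv e bal = ≡⇒balanced {j} false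
    (*-cancelʳ-≡ (m j false) (m j true) (a j i)
      {{>-nonZero (edge⇒a-pos pv pu (trans (adj-sym G v u) e))}} (begin-equality
      m j false * a j i    ≡⟨ double-count i j true ⟨
      m i true * a i j     ≡⟨ cong (_* a i j) (balanced⇒≡ {i} bal true) ⟩
      m i false * a i j    ≡⟨ double-count i j false ⟩
      m j true * a j i     ∎))

  edge⇒balanced-≡ : ∀ {u v i j} → part u ≡ just i → part v ≡ just j →
    adj G u v ≡ true → balanced i ≡ balanced j
  edge⇒balanced-≡ {u} {v} {i} {j} pu pv e with balanced i in bi | balanced j in bj
  ... | true  | true  = refl
  ... | false | false = refl
  ... | true  | false = trans (sym (edge⇒balanced-mono pu pv e bi)) bj
  ... | false | true  = trans (sym bi) (edge⇒balanced-mono pv pu (trans (adj-sym G v u) e) bj)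

  -- Stated with `adj G′` and `s′` unfolded, so that abstracting `half y i` and `balanced i` reduces
  -- both the hypothesis and the goal.
  colouring′-YX : ∀ {y x i} → part y ≡ nothing → part x ≡ just i →
    switched (half y i) (adj G y x) ≡ true → balanced i xor s x ≡ not (s y)
  colouring′-YX {y} {x} {i} py px e with half y i in h | balanced i in bal
  ... | false | false = colouring y x e
  -- The balanced cell contains `x` and hence also nodes of the colour of `y`, so the edge would
  -- force `half y i`.
  ... | false | true  = contradiction
    (trans (sym (adjacent⇒half py px e
      (subst (0 <_) (sym (balanced⇒≡ {i} bal (s y)))
        (m-pos px (colouring y x e))))) h) (λ ())
  -- The cell has no node of the colour of `y`, so any choice of neighbours in it respects the
  -- colouring.
  ... | true  | false with s x Bool.≟ s y
  ...   | yes eq = contradiction (subst (0 <_) (half-unbalanced⇒pure py h bal) (m-pos px eq)) (λ ())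
  ...   | no neq = Bool.¬-not neq
  -- Before switching `y` was adjacent to exactly the opposite class. A new neighbour `x` therefore
  -- has the colour of `y`, and recolouring the cell flips it.
  colouring′-YX {y} {x} {i} py px e | true  | true = cong not (different (s y) (s x) (trans
    (sym (χ-injective (half-balanced⇒E≡C h (balanced⇒≡ {i} bal (s y)) x px)))
    (Bool.not-injective e)))
    where
    different : ∀ b c → is (not b) c ≡ false → c ≡ b
    different true  c eq = Bool.not-injective eq
    different false c eq = eq

  colouring′ : IsColouring G′ s′
  colouring′ u v e = by-cells (part u) (part v) refl refl
    where
    xor-not : ∀ b c → b xor not c ≡ not (b xor c)
    xor-not true  c = refl
    xor-not false c = refl
    by-cells : ∀ c c′ → part u ≡ c → part v ≡ c′ → s′ v ≡ not (s′ u)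
    by-cells nothing nothing pu pv rewrite s′-Y pu | s′-Y pv =
      colouring u v (trans (sym (adj′-YY pu pv)) e)
    by-cells nothing (just i) pu pv rewrite s′-Y pu | s′-X pv =
      colouring′-YX pu pv (trans (sym (adj′-YX pu pv)) e)
    by-cells (just i) nothing pu pv rewrite s′-X pu | s′-Y pv =
      trans (sym (Bool.not-involutive (s v)))
        (cong not (sym (colouring′-YX pv pu
          (trans (sym (adj′-YX pv pu)) (trans (adj-sym G′ v u) e)))))
    by-cells (just i) (just j) pu pv rewrite s′-X pu | s′-X pv =
      trans (cong₂ _xor_ (sym (edge⇒balanced-≡ pu pv e₀)) (colouring u v e₀))
            (xor-not (balanced i) (s u))
      where e₀ = trans (sym (adj′-XX pu pv)) e

  -- Degrees and class sizes after switching.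

  nb′≡nb : ∀ {y} → part y ≡ nothing → ∀ i → Σ∈ (just i) (E′ y) ≡ nb y i
  nb′≡nb {y} py i with half y i in h
  ... | false = Σ∈-cong {just i} (λ x px → cong χ
    (trans (adj′-YX py px) (cong (λ b → switched b (adj G y x)) h)))
  -- The new neighbours are the complementary half of the cell, so old and new together exhaust it.
  ... | true  = +-cancelʳ-≡ (nb y i) _ _ (begin-equality
    Σ∈ (just i) (E′ y) + nb y i               ≡⟨ Σ∈-+ (just i) (E′ y) (E y) ⟨
    Σ∈ (just i) (λ x → E′ y x + E y x)        ≡⟨ Σ∈-cong {just i} (λ x px → complement x px) ⟩
    size (just i)                             ≡⟨ half-true h ⟨
    2 * nb y i                                ≡⟨ cong (nb y i +_) (+-identityʳ _) ⟩
    nb y i + nb y i                           ∎)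
    where
    complement : ∀ x → part x ≡ just i → E′ y x + E y x ≡ 1
    complement x px rewrite adj′-YX py px | h with adj G y x
    ... | true  = refl
    ... | false = refl

  sum-E′-Y : ∀ {y} → part y ≡ nothing → sum (E′ y) ≡ sum (E y)
  sum-E′-Y {y} py = begin-equality
    sum (E′ y)
      ≡⟨ sum-by-cells (E′ y) ⟩
    Σ∈ nothing (E′ y) + sum (λ i → Σ∈ (just i) (E′ y))
      ≡⟨ cong₂ _+_ (Σ∈-cong {nothing} (λ z pz → cong χ (adj′-YY py pz)))
                   (sum-cong-≗ (nb′≡nb py)) ⟩
    degY y + sum (nb y)
      ≡⟨ sum-by-cells (E y) ⟨
    sum (E y) ∎

  degY′ : Fin n → ℕ
  degY′ v = Σ∈ nothing (E′ v)

  sum-E′-X : ∀ {v i} → part v ≡ just i → sum (E′ v) ≡ degY′ v + degX i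
  sum-E′-X {v} {i} p = trans (sum-by-cells (E′ v)) (cong (degY′ v +_)
    (sum-cong-≗ (λ j → trans
      (Σ∈-cong {just j} (λ w pw → cong χ (adj′-XX p pw)))
      (nb≡a p j))))

  E′-XY : ∀ {x y i} → part x ≡ just i → part y ≡ nothing →
          E′ x y ≡ χ (switched (half y i) (adj G y x))
  E′-XY {x} {y} px py = cong χ (trans (adj-sym G′ x y) (adj′-YX py px))

  -- The factor E′ x y + E x y is 2, 1 or 0 according to whether y is adjacent
  -- to all, half or none of X i.
  size*[E′+E]≡2*nb : ∀ {x y i} → part x ≡ just i → part y ≡ nothing →
    size (just i) * (E′ x y + E x y) ≡ 2 * nb y i
  size*[E′+E]≡2*nb {x} {y} {i} px py rewrite E′-XY px py | E-sym x y
    with none-half-all py i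
  ... | inj₁ (h , none) rewrite h | none
      | n≤0⇒n≡0 (subst (E y x ≤_) none (term≤Σ∈ (E y) x px)) = *-zeroʳ (size (just i))
  ... | inj₂ (inj₁ h) rewrite h | half-true h with adj G y x
  ...   | true  = *-identityʳ (size (just i))
  ...   | false = *-identityʳ (size (just i))
  size*[E′+E]≡2*nb {x} {y} {i} px py | inj₂ (inj₂ (h , full))
    rewrite h | full | Σ∈-mono-≡⁻ {just i} (λ w _ → χ≤1 (adj G y w)) full x px
    = *-comm (size (just i)) 2

  Σ∈-d : ∀ i b → Σ∈ (just i) (d ∘ s) ≡ m i b * d b + m i (not b) * d (not b)
  Σ∈-d i b = begin-equality
    Σ∈ (just i) (d ∘ s)
      ≡⟨ Σ∈-cong {just i} (λ v _ → by-colour b (s v)) ⟩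
    Σ∈ (just i) (λ v → C b v * d b + C (not b) v * d (not b))
      ≡⟨ Σ∈-+ (just i) (λ v → C b v * d b) (λ v → C (not b) v * d (not b)) ⟩
    Σ∈ (just i) (λ v → C b v * d b) + Σ∈ (just i) (λ v → C (not b) v * d (not b))
      ≡⟨ cong₂ _+_ (Σ∈-* (just i) (C b) (d b)) (Σ∈-* (just i) (C (not b)) (d (not b))) ⟨
    m i b * d b + m i (not b) * d (not b) ∎
    where
    by-colour : ∀ b c → d c ≡ χ (is b c) * d b + χ (is (not b) c) * d (not b)
    by-colour true  true  = solve 1 (λ x → x := con 1 :* x :+ con 0) refl (d true)
    by-colour true  false = solve 1 (λ x → x := con 1 :* x) refl (d false)
    by-colour false true  = solve 1 (λ x → x := con 1 :* x) refl (d true)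
    by-colour false false = solve 1 (λ x → x := con 1 :* x :+ con 0) refl (d false)

  -- The right-hand side is twice the sum of the degrees over X i.
  size*[deg′+deg] : ∀ {v i} → part v ≡ just i → ∀ b →
    size (just i) * (sum (E′ v) + d (s v))
      ≡ 2 * (m i b * d b + m i (not b) * d (not b))
  size*[deg′+deg] {v} {i} p b = begin-equality
    S * (sum (E′ v) + d (s v))
      ≡⟨ cong (S *_) (cong₂ _+_ (sum-E′-X p) (degree-split p)) ⟩
    S * ((degY′ v + degX i) + (degY v + degX i))
      ≡⟨ solve 4 (λ S p q x → S :* ((p :+ x) :+ (q :+ x))
                   := S :* (p :+ q) :+ con 2 :* (S :* x)) refl S (degY′ v) (degY v) (degX i) ⟩
    S * (degY′ v + degY v) + 2 * (S * degX i)
      ≡⟨ cong (λ k → S * k + 2 * (S * degX i)) (Σ∈-+ nothing (E′ v) (E v)) ⟨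
    S * Σ∈ nothing (λ y → E′ v y + E v y) + 2 * (S * degX i)
      ≡⟨ cong (_+ 2 * (S * degX i)) (*-Σ∈ nothing S (λ y → E′ v y + E v y)) ⟩
    Σ∈ nothing (λ y → S * (E′ v y + E v y)) + 2 * (S * degX i)
      ≡⟨ cong (_+ 2 * (S * degX i)) (Σ∈-cong {nothing} (λ y py → size*[E′+E]≡2*nb p py)) ⟩
    Σ∈ nothing (λ y → 2 * nb y i) + 2 * (S * degX i)
      ≡⟨ cong (_+ 2 * (S * degX i)) (*-Σ∈ nothing 2 (λ y → nb y i)) ⟨
    2 * Σ∈ nothing (λ y → nb y i) + 2 * (S * degX i)
      ≡⟨ *-distribˡ-+ 2 (Σ∈ nothing (λ y → nb y i)) (S * degX i) ⟨
    2 * (Σ∈ nothing (λ y → nb y i) + S * degX i)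
      -- The edges between `Y` and `X i`, so far counted from `Y`, are now counted from `X i`, where
      -- they complete `degX i` to the full degrees.
      ≡⟨ cong (2 *_) (cong₂ _+_ (Σ∈-comm nothing (just i) E) (sym (Σ∈-const (just i) (degX i)))) ⟩
    2 * (Σ∈ (just i) (λ w → Σ∈ nothing (λ y → E y w)) + Σ∈ (just i) (λ _ → degX i))
      ≡⟨ cong (2 *_) (Σ∈-+ (just i) (λ w → Σ∈ nothing (λ y → E y w)) (λ _ → degX i)) ⟨
    2 * Σ∈ (just i) (λ w → Σ∈ nothing (λ y → E y w) + degX i)
      ≡⟨ cong (2 *_) (Σ∈-cong {just i} (λ w pw → trans
           (cong (_+ degX i) (Σ∈-cong {nothing} (λ y _ → E-sym y w)))
           (sym (degree-split pw)))) ⟩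
    2 * Σ∈ (just i) (d ∘ s)
      ≡⟨ cong (2 *_) (Σ∈-d i b) ⟩
    2 * (m i b * d b + m i (not b) * d (not b)) ∎
    where S = size (just i)

  -- With equal classes, twice the degree sum of the cell is its size times the sum of both degrees.
  -- Cancelling the size and the old degree leaves the other degree.
  sum-E′-balanced : ∀ {v i} → part v ≡ just i → balanced i ≡ true →
                    sum (E′ v) ≡ d (not (s v))
  sum-E′-balanced {v} {i} p bal = +-cancelʳ-≡ (d b) _ _
    (*-cancelˡ-≡ _ _ (size (just i)) {{>-nonZero (size-pos i)}} (begin-equality
      size (just i) * (sum (E′ v) + d b)
        ≡⟨ size*[deg′+deg] p b ⟩
      2 * (m i b * d b + k * d (not b))
        ≡⟨ cong (λ j → 2 * (j * d b + k * d (not b))) m≡k ⟩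
      2 * (k * d b + k * d (not b))
        ≡⟨ solve 3 (λ k x y → con 2 :* (k :* x :+ k :* y) := (k :+ k) :* (y :+ x)) refl
                 k (d b) (d (not b)) ⟩
      (k + k) * (d (not b) + d b)
        ≡⟨ cong (λ j → (j + k) * (d (not b) + d b)) m≡k ⟨
      (m i b + k) * (d (not b) + d b)
        ≡⟨ cong (_* (d (not b) + d b)) (m+m≡size i b) ⟩
      size (just i) * (d (not b) + d b) ∎))
    where
    b = s v
    k = m i (not b)
    m≡k = balanced⇒≡ {i} bal b

  -- All nodes of the cell have the same old degree, so the mean of the old and new degrees of `v`
  -- is that degree.
  sum-E′-pure : ∀ {v i} → part v ≡ just i → m i (not (s v)) ≡ 0 →
                sum (E′ v) ≡ d (s v)
  sum-E′-pure {v} {i} p pure = +-cancelʳ-≡ (d b) _ _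
    (*-cancelˡ-≡ _ _ (size (just i)) {{>-nonZero (size-pos i)}} (begin-equality
      size (just i) * (sum (E′ v) + d b)
        ≡⟨ size*[deg′+deg] p b ⟩
      2 * (m i b * d b + m i (not b) * d (not b))
        ≡⟨ cong (λ j → 2 * (m i b * d b + j * d (not b))) pure ⟩
      2 * (m i b * d b + 0)
        ≡⟨ solve 2 (λ k x → con 2 :* (k :* x :+ con 0) := (k :+ con 0) :* (x :+ x)) refl
                 (m i b) (d b) ⟩
      (m i b + 0) * (d b + d b)
        ≡⟨ cong (λ j → (m i b + j) * (d b + d b)) pure ⟨
      (m i b + m i (not b)) * (d b + d b)
        ≡⟨ cong (_* (d b + d b)) (m+m≡size i b) ⟩
      size (just i) * (d b + d b) ∎))
    where b = s v

  -- A node of `Y` attached to half of an unbalanced cell would find none of its own colour there.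
  -- This cell meets both colours, so no edge at `v` is switched.
  sum-E′-mixed : ∀ {v i} → part v ≡ just i → balanced i ≡ false →
                 m i (not (s v)) ≢ 0 → sum (E′ v) ≡ d (s v)
  sum-E′-mixed {v} {i} p unbal mixed = begin-equality
    sum (E′ v)    ≡⟨ sum-E′-X p ⟩
    degY′ v + degX i  ≡⟨ cong (_+ degX i) (Σ∈-cong {nothing} unchanged) ⟩
    degY v + degX i   ≡⟨ degree-split p ⟨
    d (s v)       ∎
    where
    both-colours : ∀ c → m i c ≢ 0
    both-colours c eq with c Bool.≟ s v
    ... | yes refl = >⇒≢ (m-pos p refl) eq
    ... | no  c≢   = mixed (trans (cong (m i) (sym (Bool.¬-not c≢))) eq)
    unchanged : ∀ y → part y ≡ nothing → E′ v y ≡ E v y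
    unchanged y py rewrite E′-XY p py | E-sym v y with half y i in h
    ... | false = refl
    ... | true  = contradiction (half-unbalanced⇒pure py h unbal) (both-colours (s y))

  degree′ : ∀ v → degree G′ v ≡ d (s′ v)
  degree′ v = trans (degree′≡sum v) (by-cell (part v) refl)
    where
    by-cell : ∀ c → part v ≡ c → sum (E′ v) ≡ d (s′ v)
    by-cell nothing  p = trans (sum-E′-Y p) (trans (sum-E v) (cong d (sym (s′-Y p))))
    by-cell (just i) p rewrite s′-X p with balanced i in bal | m i (not (s v)) ≟ 0
    ... | true  | _         = sum-E′-balanced p bal
    ... | false | yes pure  = sum-E′-pure p pure
    ... | false | no  mixed = sum-E′-mixed p bal mixed

  -- Recolouring a balanced cell exchanges two classes of equal size, and all other nodes keep their
  -- colours.
  class-size-≡ : ∀ b → sum (λ v → χ (is b (s′ v))) ≡ sum (λ v → χ (is b (s v)))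
  class-size-≡ b = begin-equality
    sum C′
      ≡⟨ sum-by-cells C′ ⟩
    Σ∈ nothing C′ + sum (λ i → Σ∈ (just i) C′)
      ≡⟨ cong₂ _+_ (Σ∈-cong {nothing} (λ y p → cong (χ ∘ is b) (s′-Y p)))
                   (sum-cong-≗ in-X) ⟩
    Σ∈ nothing (C b) + sum (λ i → m i b)
      ≡⟨ sum-by-cells (C b) ⟨
    sum (C b) ∎
    where
    C′ : Fin n → ℕ
    C′ v = χ (is b (s′ v))
    is-not : ∀ b c → is b (not c) ≡ is (not b) c
    is-not true  c = refl
    is-not false c = Bool.not-involutive c
    in-X : ∀ i → Σ∈ (just i) C′ ≡ m i b
    in-X i with balanced i in bal
    ... | false = Σ∈-cong {just i} (λ v p → cong (χ ∘ is b)
      (trans (s′-X p) (cong (_xor s v) bal)))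
    ... | true  = trans
      (Σ∈-cong {just i} (λ v p → cong χ (trans
        (cong (is b) (trans (s′-X p) (cong (_xor s v) bal))) (is-not b (s v)))))
      (sym (balanced⇒≡ {i} bal b))

-- Return from colourings to bipartitions and degree sequences.

∣∁∣≡sum : (p : Subset n) → ∣ ∁ p ∣ ≡ sum (λ v → χ (not (lookup p v)))
∣∁∣≡sum p = trans (∣∣≡sum (∁ p)) (sum-cong-≗ (λ v → cong χ (lookup-map v not p)))

theorem2 : ∀ (n ℓ : ℕ) (G : Graph n) →
    IsBiregularBipartite G →
    (P : GMPartition G ℓ) →
    IsBiregularBipartite (switch G P) × SameDegreeSequences G (switch G P)
theorem2 n ℓ G (U , bip , (dU , degU) , (dW , degW)) P =
  -- `U′` is the recoloured first side. Each side keeps its constant degree, so equal sizes suffice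
  -- for equal degree sequences.
  (U′ , bip′ , (dU , degU′) , (dW , degW′)) ,
  (U , U′ , bip , bip′
    , same-sequences degU degU′ ∣U∣≡∣U′∣
    , same-sequences degW degW′ ∣W∣≡∣W′∣)
  where
  d : Bool → ℕ
  d b = if b then dU else dW

  deg : ∀ v → degree G v ≡ d (lookup U v)
  deg v with lookup U v in eq
  ... | true  = degU v (lookup⇒[]= v U eq)
  ... | false = degW v (lookup⇒∈∁ eq)

  open Switching G (lookup U) (bipartition⇒colouring {G = G} bip) d deg P

  U′ : Subset n
  U′ = tabulate s′

  U′-lookup : ∀ v → lookup U′ v ≡ s′ v
  U′-lookup = lookup∘tabulate s′

  bip′ : IsBipartition G′ U′
  bip′ = colouring⇒bipartition {G = G′} (λ u v e →
    trans (U′-lookup v) (trans (colouring′ u v e) (cong not (sym (U′-lookup u)))))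

  degU′ : AllOfDegree G′ U′ dU
  degU′ v v∈ = trans (degree′ v)
    (cong d (trans (sym (U′-lookup v)) ([]=⇒lookup v∈)))

  degW′ : AllOfDegree G′ (∁ U′) dW
  degW′ v v∈ = trans (degree′ v)
    (cong d (trans (sym (U′-lookup v)) (∈∁⇒lookup v∈)))

  ∣U∣≡∣U′∣ : ∣ U ∣ ≡ ∣ U′ ∣
  -- `is true` and `is false` reduce to the identity and to negation, so the two instances of
  -- `class-size-≡` count the two sides directly.
  ∣U∣≡∣U′∣ = trans (∣∣≡sum U) (trans (sym (class-size-≡ true)) (sym (∣tabulate∣≡sum s′)))

  ∣W∣≡∣W′∣ : ∣ ∁ U ∣ ≡ ∣ ∁ U′ ∣
  ∣W∣≡∣W′∣ = trans (∣∁∣≡sum U) (trans (sym (class-size-≡ false))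
    (sym (trans (∣∁∣≡sum U′) (sum-cong-≗ (λ v → cong (χ ∘ not) (U′-lookup v))))))

  same-sequences : ∀ {S S′ k} → AllOfDegree G S k → AllOfDegree G′ S′ k →
    ∣ S ∣ ≡ ∣ S′ ∣ → degreeSequence G S ≡ degreeSequence G′ S′
  same-sequences {S} {S′} {k} degS degS′ eq = trans (degreeSequence-const G S degS)
    (trans (cong (λ l → replicate l k) eq) (sym (degreeSequence-const G′ S′ degS′)))
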